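{- Let $z$ be a non-zero integer. Then $$\lim_{m \to \infty} h(m! + z) = h(|z|),$$ where $h(n)=\sigma(n)/n$ and $\sigma(n)$ is the sum of the positive divisors of $n$.
   Context: For a positive integer $n$, $\sigma(n)$ is the sum of the positive divisors of $n$ and $h(n)=\sigma(n)/n$ is its abundancy. Note that $m!+z>0$ for all sufficiently large $m$, so the limit is taken over such $m$. -}

module Defs where

open import Data.Nat using (ℕ; zero; suc)
open import Data.Nat.Divisibility using (_∣?_)
open import Data.List using (filter)
open import Data.Nat.ListAction using (sum)
open import Data.List using (upTo) renaming (map to lmap)
open import Data.Integer using (ℤ; +_)
open import Data.Rational using (ℚ; _/_; 0ℚ)

-- divisors of n among 1..n (for n = 0 this is the empty list)
divisors : ℕ → Data.List.List ℕ
divisors n = filter (_∣? n) (lmap suc (upTo n))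

σ : ℕ → ℕ
σ n = sum (divisors n)

-- abundancy h(n) = σ(n)/n  (junk value 0 at n = 0, never used below)
h : ℕ → ℚ
h zero = 0ℚ
h (suc k) = (+ σ (suc k)) / suc k

{-# OPTIONS --safe #-}
module Submission where

-- Let a = |z| and n = m! + z = k a. For m ≥ 2a every divisor of n either has the form k d with d ∣ a,
-- or divides n / p for some prime p ∣ n with p > m. Since σ(n/p) ≤ σ(n)/p, this gives
--   k σ(a) ≤ σ(n) ≤ k σ(a) + σ(n) Σ 1/p,   the sum being over primes p ∣ n with p > m.
-- The sum tends to 0: for fixed K the primes in (m, Km] divide the multinomial coefficient
-- (Km)!/(m!)^K ≤ 2^(mK²), so there are at most m/K of them once m ≥ 2^(K³), while at most m + 1
-- primes exceed Km because n ≤ 2 m! ≤ m^(m+1). Hence the sum is at most 3/K.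

open import Defs
open import Data.Nat using (ℕ; _≤_)
open import Data.Nat using (_!)
open import Data.Integer using (ℤ; +_) renaming (_+_ to _+ℤ_; _<_ to _<ℤ_; ∣_∣ to ∣_∣ℤ)
open import Data.Rational using (ℚ; _<_; _-_; ∣_∣; 0ℚ)
open import Data.Product using (∃; _×_)
open import Relation.Binary.PropositionalEquality using (_≢_)

open import Data.Nat using (zero; suc; _+_; _*_; _∸_; _^_; z≤n; s≤s; NonZero; >-nonZero; ≢-nonZero; ≢-nonZero⁻¹)
import Data.Nat as ℕ
open import Data.Nat.Properties
open import Data.Nat.Combinatorics using (_C_; nCk≡n!/k![n-k]!; k![n∸k]!∣n!; k>n⇒nCk≡0; nCk+nC[k+1]≡[n+1]C[k+1])
open import Data.Nat.Coprimality using (Coprime; coprime-divisor; gcd≡1⇒coprime)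
open import Data.Nat.GCD using (gcd; gcd[m,n]≢0; gcd[m,n]∣m; gcd[m,n]∣n)
open import Data.Nat.DivMod using (m/n*n≡m)
open import Data.Nat.Divisibility
open import Data.Nat.ListAction using (sum; product)
open import Data.Nat.ListAction.Properties using (sum-++; sum-↭)
open import Data.Nat.Primality using (Prime; prime?; euclidsLemma; ¬prime[1]; prime⇒nonZero)
open import Data.Nat.Primality.Factorisation using (factorisationHasAllPrimeFactors; factorise)
open import Data.Nat.Tactic.RingSolver using (solve-∀)
open import Data.List using (List; []; _∷_; _++_; map; filter; concatMap; length; upTo)
open import Data.List.Membership.Propositional using (_∈_)
open import Data.List.Membership.Propositional.Properties
open import Data.List.Relation.Binary.Permutation.Propositional.Properties using (shift; ∈-resp-↭)
open import Data.List.Relation.Binary.Subset.Propositional using (_⊆_)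
open import Data.List.Relation.Unary.All using (All; []; _∷_)
import Data.List.Relation.Unary.All as All
open import Data.List.Relation.Unary.AllPairs using (_∷_)
open import Data.List.Relation.Unary.Any using (here; there)
open import Data.List.Relation.Unary.Unique.Propositional using (Unique)
open import Data.List.Relation.Unary.Unique.Propositional.Properties as Unique using (Unique[x∷xs]⇒x∉xs)
open import Data.Product using (_,_; proj₁; proj₂)
open import Data.Sum using (_⊎_; inj₁; inj₂)
open import Function using (case_of_)
open import Relation.Nullary using (Dec; yes; no; contradiction)
open import Relation.Nullary.Decidable using (_×-dec_)
open import Relation.Binary.PropositionalEquality using (_≡_; refl; sym; trans; cong; cong₂; subst; subst₂; module ≡-Reasoning)
open import Data.Integer using (-[1+_])
import Data.Integer as ℤ
import Data.Integer.Properties as ℤ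
open import Data.Rational using (mkℚ; toℚᵘ)
import Data.Rational as ℚ
import Data.Rational.Properties as ℚ
open import Data.Rational.Unnormalised using (mkℚᵘ)
import Data.Rational.Unnormalised as ℚᵘ
import Data.Rational.Unnormalised.Properties as ℚᵘ

-- Sums and products over lists

-- Each entry of `xs` is struck out of `ys` in turn; by uniqueness it does not recur, so the rest of
-- `xs` still lies in what remains of `ys`.
sum-⊆ : ∀ {xs ys} → Unique xs → xs ⊆ ys → sum xs ≤ sum ys
sum-⊆ {[]}     _ _ = z≤n
sum-⊆ {x ∷ xs} {ys} u@(_ ∷ uxs) xs⊆ys
  with us , vs , refl ← ∈-∃++ (xs⊆ys (here refl)) = begin
    x + sum xs          ≤⟨ +-monoʳ-≤ x (sum-⊆ uxs xs⊆us++vs) ⟩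
    x + sum (us ++ vs)  ≡⟨ sum-↭ (shift x us vs) ⟨
    sum (us ++ x ∷ vs)  ∎
  where
  open ≤-Reasoning
  xs⊆us++vs : xs ⊆ us ++ vs
  xs⊆us++vs v∈xs with ∈-resp-↭ (shift x us vs) (xs⊆ys (there v∈xs))
  ... | here refl = contradiction v∈xs (Unique[x∷xs]⇒x∉xs u)
  ... | there v∈  = v∈

sum-map-* : ∀ c xs → sum (map (c *_) xs) ≡ c * sum xs
sum-map-* c []       = sym (*-zeroʳ c)
sum-map-* c (x ∷ xs) = trans (cong (_+_ (c * x)) (sum-map-* c xs)) (sym (*-distribˡ-+ c x (sum xs)))

-- A union bound kept free of division. It is used with `xs` a list of primes, `f p` the divisors of
-- n / p, and `b` equal to `σ n`.
*-sum-concatMap-≤ : ∀ c b (f : ℕ → List ℕ) xs → (∀ {x} → x ∈ xs → c * sum (f x) ≤ b) →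
                    c * sum (concatMap f xs) ≤ length xs * b
*-sum-concatMap-≤ c b f []       _ = ≤-reflexive (*-zeroʳ c)
*-sum-concatMap-≤ c b f (x ∷ xs) f≤ = begin
  c * sum (f x ++ concatMap f xs)             ≡⟨ cong (c *_) (sum-++ (f x) _) ⟩
  c * (sum (f x) + sum (concatMap f xs))      ≡⟨ *-distribˡ-+ c (sum (f x)) _ ⟩
  c * sum (f x) + c * sum (concatMap f xs)    ≤⟨ +-mono-≤ (f≤ (here refl)) (*-sum-concatMap-≤ c b f xs (λ p → f≤ (there p))) ⟩
  b + length xs * b                           ∎
  where open ≤-Reasoning

^-length≤product : ∀ b xs → (∀ {x} → x ∈ xs → b ≤ x) → b ^ length xs ≤ product xs
^-length≤product b []       _   = ≤-refl
^-length≤product b (x ∷ xs) b≤ = *-mono-≤ (b≤ (here refl)) (^-length≤product b xs (λ p → b≤ (there p)))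

-- Prime divisors of products, powers and factorials

-- Write n as `q * product ps`. A further prime p divides q or `product ps`; the latter would put p
-- among `ps`, against uniqueness.
product-distinctPrimes-∣ : ∀ {n ps} → Unique ps → (∀ {p} → p ∈ ps → Prime p × p ∣ n) → product ps ∣ n
product-distinctPrimes-∣ {n} {[]}     _ _ = 1∣ n
product-distinctPrimes-∣ {n} {p ∷ ps} u@(_ ∷ ups) h
  with product-distinctPrimes-∣ ups (λ q∈ → h (there q∈)) | h (here refl)
... | divides q refl | prime[p] , p∣n with euclidsLemma q (product ps) prime[p] p∣n
...   | inj₁ p∣q = *-monoˡ-∣ (product ps) p∣q
...   | inj₂ p∣Πps = contradiction
          (factorisationHasAllPrimeFactors prime[p] p∣Πps (All.tabulate λ q∈ → proj₁ (h (there q∈))))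
          (Unique[x∷xs]⇒x∉xs u)

-- Counts primes by size. It is applied both to a multinomial coefficient and to n itself.
^-distinctPrimes-≤ : ∀ b {n ps} .{{_ : NonZero n}} → Unique ps →
                     (∀ {p} → p ∈ ps → b ≤ p × Prime p × p ∣ n) → b ^ length ps ≤ n
^-distinctPrimes-≤ b {ps = ps} u h =
  ≤-trans (^-length≤product b ps (λ p∈ → proj₁ (h p∈)))
          (∣⇒≤ (product-distinctPrimes-∣ u (λ p∈ → proj₂ (h p∈))))

^-cancelˡ-≤ : ∀ b {x y} → 1 ℕ.< b → b ^ x ≤ b ^ y → x ≤ y
^-cancelˡ-≤ b 1<b le = ≮⇒≥ λ y<x → <⇒≱ (^-monoʳ-< b 1<b y<x) le

∃-primeDivisor : ∀ {n} .{{_ : NonZero n}} → n ≢ 1 → ∃ λ p → Prime p × p ∣ n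
∃-primeDivisor {n} n≢1 with factorise n
... | record { factors = []     ; isFactorisation = n≡1 } = contradiction n≡1 n≢1
... | record { factors = p ∷ ps ; isFactorisation = refl ; factorsPrime = prime[p] ∷ _ } = p , prime[p] , m∣m*n (product ps)

prime∣n!⇒≤n : ∀ {p} n → Prime p → p ∣ n ! → p ≤ n
prime∣n!⇒≤n zero    prime[p] p∣1 = contradiction (subst Prime (∣1⇒≡1 p∣1) prime[p]) ¬prime[1]
prime∣n!⇒≤n (suc n) prime[p] p∣  with euclidsLemma (suc n) (n !) prime[p] p∣
... | inj₁ p∣1+n = ∣⇒≤ p∣1+n
... | inj₂ p∣n!  = m≤n⇒m≤1+n (prime∣n!⇒≤n n prime[p] p∣n!)

prime∣^⇒∣ : ∀ {p} m n → Prime p → p ∣ m ^ n → p ∣ m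
prime∣^⇒∣ m zero    prime[p] p∣1 = contradiction (subst Prime (∣1⇒≡1 p∣1) prime[p]) ¬prime[1]
prime∣^⇒∣ m (suc n) prime[p] p∣  with euclidsLemma m (m ^ n) prime[p] p∣
... | inj₁ p∣m = p∣m
... | inj₂ p∣mⁿ = prime∣^⇒∣ m n prime[p] p∣mⁿ

m∣n! : ∀ {m n} .{{_ : NonZero m}} → m ≤ n → m ∣ n !
m∣n! {suc m} m≤n = ∣-trans (m∣m*n (m !)) (m≤n⇒m!∣n! m≤n)

m!≤m^m : ∀ m → m ! ≤ m ^ m
m!≤m^m zero    = ≤-refl
m!≤m^m (suc m) = *-monoʳ-≤ (suc m) (≤-trans (m!≤m^m m) (^-monoˡ-≤ m (n≤1+n m)))

-- Multinomial coefficients and primes in (m, Km]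

nCk≤2^n : ∀ n k → n C k ≤ 2 ^ n
nCk≤2^n zero    zero    = ≤-refl
nCk≤2^n zero    (suc k) = ≤-trans (≤-reflexive (k>n⇒nCk≡0 {0} {suc k} (s≤s z≤n))) z≤n
nCk≤2^n (suc n) zero    = m^n>0 2 (suc n)
nCk≤2^n (suc n) (suc k) = begin
  suc n C suc k        ≡⟨ nCk+nC[k+1]≡[n+1]C[k+1] n k ⟨
  n C k + n C suc k    ≤⟨ +-mono-≤ (nCk≤2^n n k) (nCk≤2^n n (suc k)) ⟩
  2 ^ n + 2 ^ n        ≡⟨ cong (_+_ (2 ^ n)) (+-identityʳ (2 ^ n)) ⟨
  2 ^ suc n            ∎
  where open ≤-Reasoning

[m+n]Cm*m!*n! : ∀ m n → ((m + n) C m) * (m ! * n !) ≡ (m + n) !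
[m+n]Cm*m!*n! m n = begin
  ((m + n) C m) * (m ! * n !)            ≡⟨ cong (λ x → ((m + n) C m) * (m ! * x !)) (m+n∸m≡n m n) ⟨
  ((m + n) C m) * (m ! * (m + n ∸ m) !)  ≡⟨ cong (_* (m ! * (m + n ∸ m) !)) (nCk≡n!/k![n-k]! (m≤m+n m n)) ⟩
  _                                      ≡⟨ m/n*n≡m {{m !* (m + n ∸ m) !≢0}} (k![n∸k]!∣n! (m≤m+n m n)) ⟩
  (m + n) !                              ∎
  where open ≡-Reasoning

-- M is the multinomial coefficient (jm)! / (m!)^j, built up as a product of binomial coefficients,
-- each bounded by a power of 2.
multinomial : ∀ m j → ∃ λ M → M * (m !) ^ j ≡ (j * m) ! × M ≤ 2 ^ (m * (j * j))
multinomial m zero    = 1 , refl , m^n>0 2 (m * 0)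
multinomial m (suc j) with M , M-eq , M≤ ← multinomial m j = M * c , eq , bound
  where
  c = (m + j * m) C m
  rearrange : ∀ M c f g → M * c * (f * g) ≡ c * (f * (M * g))
  rearrange = solve-∀
  eq : M * c * (m ! * (m !) ^ j) ≡ (m + j * m) !
  eq = trans (rearrange M c (m !) ((m !) ^ j))
             (trans (cong (λ x → c * (m ! * x)) M-eq) ([m+n]Cm*m!*n! m (j * m)))
  exponent : ∀ m j → m * (suc j * suc j) ≡ m * (j * j) + (m + j * m) + j * m
  exponent = solve-∀
  bound : M * c ≤ 2 ^ (m * (suc j * suc j))
  bound = begin
    M * c                                ≤⟨ *-mono-≤ M≤ (nCk≤2^n (m + j * m) m) ⟩
    2 ^ (m * (j * j)) * 2 ^ (m + j * m)  ≡⟨ ^-distribˡ-+-* 2 (m * (j * j)) (m + j * m) ⟨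
    -- The slack `j * m` completes the square in the exponent.
    2 ^ (m * (j * j) + (m + j * m))      ≤⟨ ^-monoʳ-≤ 2 (m≤m+n (m * (j * j) + (m + j * m)) (j * m)) ⟩
    2 ^ (m * (j * j) + (m + j * m) + j * m) ≡⟨ cong (2 ^_) (exponent m j) ⟨
    2 ^ (m * (suc j * suc j))            ∎
    where open ≤-Reasoning

-- A prime in (m, Km] divides (Km)! but not (m!)^K, hence divides M. All these primes exceed 2^(K³),
-- so 2^(K³ · `length ps`) ≤ M ≤ 2^(mK²), and the exponents are compared.
primesInInterval-≤ : ∀ K m ps .{{_ : NonZero K}} → 2 ^ (K * K * K) ≤ m → Unique ps →
                     (∀ {p} → p ∈ ps → Prime p × m ℕ.< p × p ≤ K * m) → K * length ps ≤ m
primesInInterval-≤ K m ps 2^K³≤m u h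
  with M , M-eq , M≤ ← multinomial m K = *-cancelˡ-≤ (K * K) {{m*n≢0 K K}} (begin
    K * K * (K * length ps)  ≡⟨ *-assoc (K * K) K (length ps) ⟨
    K * K * K * length ps    ≤⟨ ^-cancelˡ-≤ 2 ≤-refl power≤ ⟩
    m * (K * K)              ≡⟨ *-comm m (K * K) ⟩
    K * K * m                ∎)
  where
  open ≤-Reasoning
  M≢0 : NonZero M
  M≢0 = m*n≢0⇒m≢0 M {{subst NonZero (sym M-eq) ((K * m) !≢0)}}
  p∣M : ∀ {p} → p ∈ ps → p ∣ M
  p∣M p∈ with prime[p] , m<p , p≤Km ← h p∈
    with euclidsLemma M ((m !) ^ K) prime[p]
           (subst (_ ∣_) (sym M-eq) (m∣n! {{prime⇒nonZero prime[p]}} p≤Km))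
  ... | inj₁ p∣M = p∣M
  ... | inj₂ p∣  = contradiction (prime∣n!⇒≤n m prime[p] (prime∣^⇒∣ (m !) K prime[p] p∣)) (<⇒≱ m<p)
  power≤ : 2 ^ (K * K * K * length ps) ≤ 2 ^ (m * (K * K))
  power≤ = begin
    2 ^ (K * K * K * length ps)    ≡⟨ ^-*-assoc 2 (K * K * K) (length ps) ⟨
    (2 ^ (K * K * K)) ^ length ps  ≤⟨ ^-distinctPrimes-≤ (2 ^ (K * K * K)) {{M≢0}} u (λ p∈ →
                                        let prime[p] , m<p , _ = h p∈ in
                                        ≤-trans 2^K³≤m (<⇒≤ m<p) , prime[p] , p∣M p∈) ⟩
    M                              ≤⟨ M≤ ⟩
    2 ^ (m * (K * K))              ∎

-- Divisor lists and lower bounds for σ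

∈-divisors⁺ : ∀ {d n} .{{_ : NonZero n}} → d ∣ n → d ∈ divisors n
∈-divisors⁺ {zero}  {n} d∣n = contradiction (0∣⇒≡0 d∣n) (≢-nonZero⁻¹ n)
∈-divisors⁺ {suc d} {n} d∣n = ∈-filter⁺ (_∣? n) (∈-map⁺ suc (∈-upTo⁺ (∣⇒≤ d∣n))) d∣n

∈-divisors⁻ : ∀ {d n} → d ∈ divisors n → d ∣ n
∈-divisors⁻ {n = n} d∈ = proj₂ (∈-filter⁻ (_∣? n) {xs = map suc (upTo n)} d∈)

divisors-unique : ∀ n → Unique (divisors n)
divisors-unique n = Unique.filter⁺ (_∣? n) (Unique.map⁺ suc-injective (Unique.upTo⁺ n))

-- Multiplication by c is injective, so the numbers `c * x` are distinct divisors of n.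
*-sum≤σ : ∀ c n xs .{{_ : NonZero c}} .{{_ : NonZero n}} → Unique xs →
          (∀ {x} → x ∈ xs → c * x ∣ n) → c * sum xs ≤ σ n
*-sum≤σ c n xs u h = subst (_≤ σ n) (sum-map-* c xs)
  (sum-⊆ (Unique.map⁺ (λ {x} {y} → *-cancelˡ-≡ x y c) u) λ v∈ →
    case ∈-map⁻ (c *_) v∈ of λ { (x , x∈ , refl) → ∈-divisors⁺ (h x∈) })

*-σ≤σ : ∀ k a .{{_ : NonZero (k * a)}} → k * σ a ≤ σ (k * a)
*-σ≤σ k a = *-sum≤σ k (k * a) (divisors a) {{m*n≢0⇒m≢0 k}} (divisors-unique a)
              (λ x∈ → *-monoʳ-∣ k (∈-divisors⁻ x∈))

divisorsWithMultiple : ℕ → ℕ → List ℕ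
divisorsWithMultiple n p = filter (λ d → p * d ∣? n) (divisors n)

*-sum-divisorsWithMultiple≤σ : ∀ n p .{{_ : NonZero p}} .{{_ : NonZero n}} →
                               p * sum (divisorsWithMultiple n p) ≤ σ n
*-sum-divisorsWithMultiple≤σ n p = *-sum≤σ p n _ (Unique.filter⁺ _ (divisors-unique n))
  (λ x∈ → proj₂ (∈-filter⁻ (λ d → p * d ∣? n) {xs = divisors n} x∈))

-- Divisors of n = k a

-- If p ≤ a, then p ≤ m - a, so p divides (m - a)! while a divides a!, and a! (m - a)! divides m!.
-- If p > a, then a divides (p - 1)!, so p a divides p!, which divides m!.
prime*∣! : ∀ {p m} a .{{_ : NonZero a}} → Prime p → p ≤ m → 2 * a ≤ m → p * a ∣ m !
prime*∣! {p} {m} a prime[p] p≤m 2a≤m with ≤-<-connex p a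
... | inj₁ p≤a = ∣-trans (*-pres-∣ (m∣n! {{prime⇒nonZero prime[p]}} p≤m∸a) (m∣n! ≤-refl))
                         (subst (_∣ m !) (*-comm (a !) ((m ∸ a) !)) (k![n∸k]!∣n! (≤-trans (m≤n*m a 2) 2a≤m)))
  where
  p≤m∸a : p ≤ m ∸ a
  p≤m∸a = ≤-trans p≤a (m+n≤o⇒m≤o∸n a (subst (λ x → a + x ≤ m) (+-identityʳ a) 2a≤m))
... | inj₂ (s≤s {n = q} a≤q) = ∣-trans (*-monoʳ-∣ (suc q) (m∣n! a≤q)) (m≤n⇒m!∣n! p≤m)

module _ {n k a m : ℕ} {{n≢0 : NonZero n}} (n≡k*a : n ≡ k * a)
         (common : ∀ {e} → e ∣ m ! → e ∣ n → e ∣ a) (2a≤m : 2 * a ≤ m) where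

  private
    instance
      k*a≢0 : NonZero (k * a)
      k*a≢0 = subst NonZero n≡k*a n≢0
      k≢0 : NonZero k
      k≢0 = m*n≢0⇒m≢0 k
      a≢0 : NonZero a
      a≢0 = m*n≢0⇒n≢0 k

  -- If p ≤ m, then p a divides both m! and n, so `common` makes it divide a, which forces p = 1.
  prime∣k⇒>m : ∀ {p} → Prime p → p ∣ k → m ℕ.< p
  prime∣k⇒>m {p} prime[p] p∣k = ≰⇒> λ p≤m →
    let p*a∣a = common (prime*∣! a prime[p] p≤m 2a≤m) (subst (p * a ∣_) (sym n≡k*a) (*-monoˡ-∣ a p∣k))
        p∣1   = *-cancelʳ-∣ a (subst (p * a ∣_) (sym (*-identityˡ a)) p*a∣a)
    in ¬prime[1] (subst Prime (∣1⇒≡1 p∣1) prime[p])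

  -- If e is coprime to k, it divides a. Otherwise a prime factor of gcd(e, k) divides k and
  -- therefore exceeds m.
  largePrime-or-∣a : ∀ {e} → e ∣ n → (∃ λ p → Prime p × m ℕ.< p × p ∣ e) ⊎ e ∣ a
  largePrime-or-∣a {e} e∣n with gcd e k ≟ 1
  ... | yes g≡1 = inj₂ (coprime-divisor (gcd≡1⇒coprime g≡1) (subst (e ∣_) n≡k*a e∣n))
  ... | no  g≢1 with p , prime[p] , p∣g ← ∃-primeDivisor {{≢-nonZero (gcd[m,n]≢0 e k (inj₂ (≢-nonZero⁻¹ k)))}} g≢1
      = inj₁ (p , prime[p] , prime∣k⇒>m prime[p] (∣-trans p∣g (gcd[m,n]∣n e k)) , ∣-trans p∣g (gcd[m,n]∣m e k))

  -- The dichotomy is applied to the cofactor e = n / d. A large prime p dividing e gives p d ∣ n;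
  -- if instead a = d′ e, cancelling e in d e = k d′ e gives d = k d′.
  divisor-cases : ∀ {d} → d ∣ n → (∃ λ d′ → d′ ∣ a × d ≡ k * d′) ⊎
                                  (∃ λ p → Prime p × m ℕ.< p × p * d ∣ n)
  divisor-cases {d} (divides e n≡e*d) with largePrime-or-∣a (divides d (trans n≡e*d (*-comm e d)))
  ... | inj₁ (p , prime[p] , m<p , p∣e) =
          inj₂ (p , prime[p] , m<p , subst (p * d ∣_) (sym n≡e*d) (*-monoˡ-∣ d p∣e))
  ... | inj₂ (divides d′ a≡d′*e) = inj₁ (d′ , divides e (trans a≡d′*e (*-comm d′ e)) ,
          *-cancelˡ-≡ d (k * d′) e {{m*n≢0⇒m≢0 e {{subst NonZero n≡e*d n≢0}}}} (begin
            e * d         ≡⟨ n≡e*d ⟨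
            n             ≡⟨ n≡k*a ⟩
            k * a         ≡⟨ cong (k *_) a≡d′*e ⟩
            k * (d′ * e)  ≡⟨ *-assoc k d′ e ⟨
            k * d′ * e    ≡⟨ *-comm (k * d′) e ⟩
            e * (k * d′)  ∎))
    where open ≡-Reasoning

  -- Contribution of the primes above m

  module _ (K : ℕ) {{K≢0 : NonZero K}} (1<m : 1 ℕ.< m) (2^K³≤m : 2 ^ (K * K * K) ≤ m) (n≤2*m! : n ≤ 2 * m !) where

    private
      instance
        m≢0 : NonZero m
        m≢0 = >-nonZero (<-trans (s≤s z≤n) 1<m)

      -- The primes are split at Km: up to Km the multinomial bound counts them, while beyond Km
      -- each has so small a reciprocal that a cruder count suffices.
      mid? : ∀ p → Dec ((Prime p × m ℕ.< p) × p ≤ K * m)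
      mid? p = (prime? p ×-dec m <? p) ×-dec p ≤? K * m

      big? : ∀ p → Dec ((Prime p × m ℕ.< p) × K * m ℕ.< p)
      big? p = (prime? p ×-dec m <? p) ×-dec K * m <? p

      mids bigs : List ℕ
      mids = filter mid? (divisors n)
      bigs = filter big? (divisors n)

      ∈-mids⁻ : ∀ {p} → p ∈ mids → p ∈ divisors n × (Prime p × m ℕ.< p) × p ≤ K * m
      ∈-mids⁻ = ∈-filter⁻ mid? {xs = divisors n}

      ∈-bigs⁻ : ∀ {p} → p ∈ bigs → p ∈ divisors n × (Prime p × m ℕ.< p) × K * m ℕ.< p
      ∈-bigs⁻ = ∈-filter⁻ big? {xs = divisors n}

      Σmids Σbigs : ℕ
      Σmids = sum (concatMap (divisorsWithMultiple n) mids)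
      Σbigs = sum (concatMap (divisorsWithMultiple n) bigs)

      sum-divisorsWithMultiple-≤ : ∀ {p c} → Prime p → c ≤ p → c * sum (divisorsWithMultiple n p) ≤ σ n
      sum-divisorsWithMultiple-≤ {p} prime[p] c≤p =
        ≤-trans (*-monoˡ-≤ _ c≤p) (*-sum-divisorsWithMultiple≤σ n p {{prime⇒nonZero prime[p]}})

      -- The lists on the right may overlap: `sum-⊆` asks for uniqueness on the left only.
      divisors-⊆ : divisors n ⊆ map (k *_) (divisors a) ++
                                concatMap (divisorsWithMultiple n) mids ++
                                concatMap (divisorsWithMultiple n) bigs
      divisors-⊆ {d} d∈ with divisor-cases (∈-divisors⁻ d∈)
      ... | inj₁ (d′ , d′∣a , refl) = ∈-++⁺ˡ (∈-map⁺ (k *_) (∈-divisors⁺ d′∣a))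
      ... | inj₂ (p , prime[p] , m<p , p*d∣n) = ∈-++⁺ʳ (map (k *_) (divisors a)) (place (≤-<-connex p (K * m)))
        where
        p∈ : p ∈ divisors n
        p∈ = ∈-divisors⁺ (m*n∣⇒m∣ p d p*d∣n)
        d∈p : d ∈ divisorsWithMultiple n p
        d∈p = ∈-filter⁺ (λ d → p * d ∣? n) d∈ p*d∣n
        place : p ≤ K * m ⊎ K * m ℕ.< p → _
        place (inj₁ p≤) = ∈-++⁺ˡ (∈-concat⁺′ d∈p (∈-map⁺ (divisorsWithMultiple n)
                               (∈-filter⁺ mid? p∈ ((prime[p] , m<p) , p≤))))
        place (inj₂ p>) = ∈-++⁺ʳ (concatMap (divisorsWithMultiple n) mids)
                               (∈-concat⁺′ d∈p (∈-map⁺ (divisorsWithMultiple n)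
                               (∈-filter⁺ big? p∈ ((prime[p] , m<p) , p>))))

      σ≤ : σ n ≤ k * σ a + (Σmids + Σbigs)
      σ≤ = ≤-trans (sum-⊆ (divisors-unique n) divisors-⊆)
             (≤-reflexive (trans (sum-++ (map (k *_) (divisors a)) _)
               (cong₂ _+_ (sum-map-* k (divisors a))
                          (sum-++ (concatMap (divisorsWithMultiple n) mids) _))))

      -- Each prime contributes at most σ(n) / m, and there are at most m / K of them.
      K*Σmids≤ : K * Σmids ≤ σ n
      K*Σmids≤ = *-cancelˡ-≤ m (begin
        m * (K * Σmids)            ≡⟨ *-comm-middle m K Σmids ⟩
        K * (m * Σmids)            ≤⟨ *-monoʳ-≤ K (*-sum-concatMap-≤ m (σ n) _ mids λ p∈ →
                                        let _ , (prime[p] , m<p) , _ = ∈-mids⁻ p∈ in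
                                        sum-divisorsWithMultiple-≤ prime[p] (<⇒≤ m<p)) ⟩
        K * (length mids * σ n)    ≡⟨ *-assoc K (length mids) (σ n) ⟨
        K * length mids * σ n      ≤⟨ *-monoˡ-≤ (σ n) (primesInInterval-≤ K m mids 2^K³≤m
                                        (Unique.filter⁺ mid? (divisors-unique n)) λ p∈ →
                                        let _ , (prime[p] , m<p) , p≤ = ∈-mids⁻ p∈ in prime[p] , m<p , p≤) ⟩
        m * σ n                    ∎)
        where
        open ≤-Reasoning
        *-comm-middle : ∀ x y z → x * (y * z) ≡ y * (x * z)
        *-comm-middle = solve-∀

      -- The product of these primes divides n, and n ≤ 2 m! ≤ m · m^m.
      length-bigs≤ : length bigs ≤ suc m
      length-bigs≤ = ^-cancelˡ-≤ m 1<m (begin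
        m ^ length bigs  ≤⟨ ^-distinctPrimes-≤ m (Unique.filter⁺ big? (divisors-unique n)) (λ p∈ →
                              let p∈divs , (prime[p] , m<p) , _ = ∈-bigs⁻ p∈ in
                              <⇒≤ m<p , prime[p] , ∈-divisors⁻ p∈divs) ⟩
        n                ≤⟨ n≤2*m! ⟩
        2 * m !          ≤⟨ *-mono-≤ 1<m (m!≤m^m m) ⟩
        m ^ suc m        ∎)
        where open ≤-Reasoning

      -- Each prime contributes at most σ(n) / (Km), and there are at most m + 1 ≤ 2m of them.
      K*Σbigs≤ : K * Σbigs ≤ 2 * σ n
      K*Σbigs≤ = *-cancelˡ-≤ m (begin
        m * (K * Σbigs)      ≡⟨ rearrange m K Σbigs ⟩
        K * m * Σbigs        ≤⟨ *-sum-concatMap-≤ (K * m) (σ n) _ bigs (λ p∈ →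
                                  let _ , (prime[p] , _) , Km<p = ∈-bigs⁻ p∈ in
                                  sum-divisorsWithMultiple-≤ prime[p] (<⇒≤ Km<p)) ⟩
        length bigs * σ n    ≤⟨ *-monoˡ-≤ (σ n) (≤-trans length-bigs≤ (+-monoˡ-≤ m (<⇒≤ 1<m))) ⟩
        (m + m) * σ n        ≡⟨ double m (σ n) ⟩
        m * (2 * σ n)        ∎)
        where
        open ≤-Reasoning
        rearrange : ∀ x y z → x * (y * z) ≡ y * x * z
        rearrange = solve-∀
        double : ∀ x y → (x + x) * y ≡ x * (2 * y)
        double = solve-∀

    K*σ≤ : K * σ n ≤ K * (k * σ a) + 3 * σ n
    K*σ≤ = begin
      K * σ n                                    ≤⟨ *-monoʳ-≤ K σ≤ ⟩
      K * (k * σ a + (Σmids + Σbigs))            ≡⟨ expand K (k * σ a) Σmids Σbigs ⟩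
      K * (k * σ a) + (K * Σmids + K * Σbigs)    ≤⟨ +-monoʳ-≤ (K * (k * σ a)) (+-mono-≤ K*Σmids≤ K*Σbigs≤) ⟩
      K * (k * σ a) + (σ n + 2 * σ n)            ∎
      where
      open ≤-Reasoning
      expand : ∀ x y u v → x * (y + (u + v)) ≡ x * y + (x * u + x * v)
      expand = solve-∀

-- Comparing abundancies as rationals

toℚᵘ-h : ∀ k → toℚᵘ (h (suc k)) ℚᵘ.≃ mkℚᵘ (+ σ (suc k)) k
toℚᵘ-h k = ℚ.toℚᵘ-fromℚᵘ (mkℚᵘ (+ σ (suc k)) k)

h-mono : ∀ a n .{{_ : NonZero a}} .{{_ : NonZero n}} → σ a * n ≤ σ n * a → h a ℚ.≤ h n
h-mono (suc a) (suc n) le = ℚ.toℚᵘ-cancel-≤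
  (ℚᵘ.≤-respˡ-≃ (ℚᵘ.≃-sym (toℚᵘ-h a)) (ℚᵘ.≤-respʳ-≃ (ℚᵘ.≃-sym (toℚᵘ-h n))
    (ℚᵘ.*≤* (subst₂ ℤ._≤_ (ℤ.pos-* (σ (suc a)) (suc n)) (ℤ.pos-* (σ (suc n)) (suc a)) (ℤ.+≤+ le)))))

-- `mkℚ` stores the denominator minus one, so ε is p / `suc q`; the hypothesis is the conclusion
-- with denominators cleared.
h<ε+h : ∀ a n {p q} .{c : Coprime p (suc q)} .{{_ : NonZero a}} .{{_ : NonZero n}} →
        σ n * (suc q * a) ℕ.< (p * a + σ a * suc q) * n → h n ℚ.< mkℚ (+ p) q c ℚ.+ h a
h<ε+h (suc a) (suc n) {p} {q} {c} lt = ℚ.toℚᵘ-cancel-<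
  (ℚᵘ.<-respˡ-≃ (ℚᵘ.≃-sym (toℚᵘ-h n)) (ℚᵘ.<-respʳ-≃
    (ℚᵘ.≃-sym (ℚᵘ.≃-trans (ℚ.toℚᵘ-homo-+ (mkℚ (+ p) q c) (h (suc a))) (ℚᵘ.+-congʳ (mkℚᵘ (+ p) q) (toℚᵘ-h a))))
    (ℚᵘ.*<* (subst₂ ℤ._<_ (ℤ.pos-* (σ (suc n)) (suc q * suc a)) rhs (ℤ.+<+ lt)))))
  where
  rhs : + ((p * suc a + σ (suc a) * suc q) * suc n) ≡
        (+ p ℤ.* + suc a ℤ.+ + σ (suc a) ℤ.* + suc q) ℤ.* + suc n
  rhs = trans (ℤ.pos-* (p * suc a + σ (suc a) * suc q) (suc n)) (cong (ℤ._* + suc n)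
          (trans (ℤ.pos-+ (p * suc a) (σ (suc a) * suc q))
                 (cong₂ ℤ._+_ (ℤ.pos-* p (suc a)) (ℤ.pos-* (σ (suc a)) (suc q)))))

q≤p<ε+q⇒∣p-q∣<ε : ∀ {p q ε} → q ℚ.≤ p → p ℚ.< ε ℚ.+ q → ∣ p - q ∣ ℚ.< ε
q≤p<ε+q⇒∣p-q∣<ε {p} {q} {ε} q≤p p<ε+q = subst (ℚ._< ε) (sym (ℚ.0≤p⇒∣p∣≡p 0≤p-q))
  (subst (p - q ℚ.<_) ε+q-q≡ε (ℚ.+-monoˡ-< (ℚ.- q) p<ε+q))
  where
  0≤p-q : 0ℚ ℚ.≤ p - q
  0≤p-q = subst (ℚ._≤ p - q) (ℚ.+-inverseʳ q) (ℚ.+-monoˡ-≤ (ℚ.- q) q≤p)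
  ε+q-q≡ε : ε ℚ.+ q - q ≡ ε
  ε+q-q≡ε = trans (ℚ.+-assoc ε q (ℚ.- q)) (trans (cong (ε ℚ.+_) (ℚ.+-inverseʳ q)) (ℚ.+-identityʳ ε))

-- Choice of K

-- For K ≥ 6 the error 3S is at most half of K S. This crude bound lets the error be restated in
-- terms of X alone.
K*S≤K*X+3*S⇒S≤2*X : ∀ K S X .{{_ : NonZero K}} → 6 ≤ K → K * S ≤ K * X + 3 * S → S ≤ 2 * X
K*S≤K*X+3*S⇒S≤2*X K S X 6≤K le = *-cancelˡ-≤ K (+-cancelˡ-≤ (K * S) (K * S) (K * (2 * X)) (begin
  K * S + K * S                      ≤⟨ +-mono-≤ le le ⟩
  (K * X + 3 * S) + (K * X + 3 * S)  ≡⟨ regroup K S X ⟩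
  6 * S + K * (2 * X)                ≤⟨ +-monoˡ-≤ _ (*-monoˡ-≤ S 6≤K) ⟩
  K * S + K * (2 * X)                ∎))
  where
  open ≤-Reasoning
  regroup : ∀ K S X → (K * X + 3 * S) + (K * X + 3 * S) ≡ 6 * S + K * (2 * X)
  regroup = solve-∀

-- Here S = σ(n), s = σ(a) and Q is the denominator of ε. The error 3S is at most 6 k s, so after
-- scaling by Q / K it is below k because K > 6 s Q. The summand 6 in K gives both K ≥ 6 and
-- strictness.
S*Q<k*s*Q+k : ∀ K S k s Q .{{_ : NonZero K}} .{{_ : NonZero k}} → K ≡ 6 + 6 * (s * Q) →
              K * S ≤ K * (k * s) + 3 * S → S * Q ℕ.< k * s * Q + k
S*Q<k*s*Q+k K S k s Q K≡ le = *-cancelˡ-< K _ _ (begin-strict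
  K * (S * Q)                                  ≡⟨ *-assoc K S Q ⟨
  K * S * Q                                    ≤⟨ *-monoˡ-≤ Q le ⟩
  (K * (k * s) + 3 * S) * Q                    ≤⟨ *-monoˡ-≤ Q (+-monoʳ-≤ (K * (k * s)) (*-monoʳ-≤ 3
                                                    (K*S≤K*X+3*S⇒S≤2*X K S (k * s) 6≤K le))) ⟩
  (K * (k * s) + 3 * (2 * (k * s))) * Q        ≡⟨ regroup K k s Q ⟩
  K * (k * s * Q) + 6 * (s * Q) * k            <⟨ +-monoʳ-< (K * (k * s * Q)) (*-monoˡ-< k 6sQ<K) ⟩
  K * (k * s * Q) + K * k                      ≡⟨ *-distribˡ-+ K (k * s * Q) k ⟨
  K * (k * s * Q + k)                          ∎)
  where
  open ≤-Reasoning
  6≤K : 6 ≤ K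
  6≤K = subst (6 ≤_) (sym K≡) (m≤m+n 6 _)
  6sQ<K : 6 * (s * Q) ℕ.< K
  6sQ<K = subst (6 * (s * Q) ℕ.<_) (sym K≡) (m<n+m (6 * (s * Q)) {6} (s≤s z≤n))
  regroup : ∀ K k s Q → (K * (k * s) + 3 * (2 * (k * s))) * Q ≡ K * (k * s * Q) + 6 * (s * Q) * k
  regroup = solve-∀

-- Dividing the hypothesis by k a Q gives S / (k a) < s / a + 1 / (a Q), and 1 / (a Q) is at most ε
-- = `suc p` / Q.
crossMultiplied-< : ∀ S k a s Q p .{{_ : NonZero a}} → S * Q ℕ.< k * s * Q + k →
                    S * (Q * a) ℕ.< (suc p * a + s * Q) * (k * a)
crossMultiplied-< S k a s Q p lt = begin-strict
  S * (Q * a)                              ≡⟨ *-assoc S Q a ⟨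
  S * Q * a                                <⟨ *-monoˡ-< a lt ⟩
  (k * s * Q + k) * a                      ≡⟨ regroup k s Q a ⟩
  k * a + s * Q * (k * a)                  ≤⟨ +-monoˡ-≤ (s * Q * (k * a)) (m≤n*m (k * a) (suc p * a) {{m*n≢0 (suc p) a}}) ⟩
  suc p * a * (k * a) + s * Q * (k * a)    ≡⟨ *-distribʳ-+ (k * a) (suc p * a) (s * Q) ⟨
  (suc p * a + s * Q) * (k * a)            ∎
  where
  open ≤-Reasoning
  regroup : ∀ k s Q a → (k * s * Q + k) * a ≡ k * a + s * Q * (k * a)
  regroup = solve-∀

-- Threshold for m and the two signs of z

-- The summands secure 2a ≤ m, 1 < m and 2^(K³) ≤ m respectively.
threshold : ℕ → ℕ → ℕ
threshold a K = 2 * a + (2 + 2 ^ (K * K * K))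

-- Since a divides n, h(a) ≤ h(n), so only the upper bound from `K*σ≤` remains. The hypotheses on n
-- are what both signs of z have in common.
∣h-h∣<ε : ∀ {n a m p q} .{c : Coprime (suc p) (suc q)} K .{{_ : NonZero a}} {{_ : NonZero n}} → K ≡ 6 + 6 * (σ a * suc q) →
          threshold a K ≤ m → a ∣ n → (∀ {e} → e ∣ m ! → e ∣ n → e ∣ a) → n ≤ 2 * m ! →
          ∣ h n - h a ∣ ℚ.< mkℚ (+ suc p) q c
∣h-h∣<ε {a = a} {m} {p} {q} K {{a≢0}} {{n≢0}} K≡ M≤m (divides k refl) common n≤2*m! =
  q≤p<ε+q⇒∣p-q∣<ε
    (h-mono a (k * a) (begin
      σ a * (k * a)  ≡⟨ rearrange (σ a) k a ⟩
      k * σ a * a    ≤⟨ *-monoˡ-≤ a (*-σ≤σ k a) ⟩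
      σ (k * a) * a  ∎))
    (h<ε+h a (k * a) (crossMultiplied-< (σ (k * a)) k a (σ a) (suc q) p
      (S*Q<k*s*Q+k K (σ (k * a)) k (σ a) (suc q) K≡
        (K*σ≤ {k = k} refl common 2a≤m K 1<m 2^K³≤m n≤2*m!))))
  where
  open ≤-Reasoning
  instance
    k≢0 : NonZero k
    k≢0 = m*n≢0⇒m≢0 k
    K≢0 : NonZero K
    K≢0 = subst NonZero (sym K≡) _
  rearrange : ∀ x y z → x * (y * z) ≡ y * x * z
  rearrange = solve-∀
  2a≤m : 2 * a ≤ m
  2a≤m = m+n≤o⇒m≤o (2 * a) M≤m
  2+2^K³≤m : 2 + 2 ^ (K * K * K) ≤ m
  2+2^K³≤m = m+n≤o⇒n≤o (2 * a) M≤m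
  1<m : 1 ℕ.< m
  1<m = m+n≤o⇒m≤o 2 2+2^K³≤m
  2^K³≤m : 2 ^ (K * K * K) ≤ m
  2^K³≤m = m+n≤o⇒n≤o 2 2+2^K³≤m

n≤n! : ∀ n → n ≤ n !
n≤n! zero    = z≤n
n≤n! (suc n) = ∣⇒≤ {{suc n !≢0}} (m∣m*n (n !))

theorem3 : (z : ℤ) → z ≢ + 0 → (ε : ℚ) → 0ℚ < ε →
    ∃ λ (M : ℕ) → (m : ℕ) → M ≤ m →
    (+ 0 <ℤ (+ (m !)) +ℤ z) × (∣ h ∣ (+ (m !)) +ℤ z ∣ℤ - h ∣ z ∣ℤ ∣ < ε)
theorem3 z z≢0 (mkℚ (+ zero)  q c) (ℚ.*<* (ℤ.+<+ ()))
theorem3 z z≢0 (mkℚ -[1+ p ] q c) (ℚ.*<* ())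
theorem3 (+ zero) z≢0 ε 0<ε = contradiction refl z≢0
theorem3 (+ suc b) z≢0 (mkℚ (+ suc p) q c) 0<ε = threshold a K , λ m M≤m →
  let a≤m = ≤-trans (m≤n*m a 2) (m+n≤o⇒m≤o (2 * a) M≤m) in
  ℤ.+<+ (≤-trans (1≤n! m) (m≤m+n (m !) a)) ,
  ∣h-h∣<ε K {{_}} {{>-nonZero (≤-trans (1≤n! m) (m≤m+n (m !) a))}} refl M≤m
    (∣m∣n⇒∣m+n (m∣n! a≤m) ∣-refl)
    (λ e∣m! e∣n → ∣m+n∣m⇒∣n e∣n e∣m!)
    -- Here n = m! + a with a ≤ m ≤ m!, which is where the factor 2 in `n ≤ 2 * m !` comes from.
    (+-monoʳ-≤ (m !) (≤-trans (≤-trans a≤m (n≤n! m)) (m≤m+n (m !) 0)))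
  where
  a K : ℕ
  a = suc b
  K = 6 + 6 * (σ a * suc q)
theorem3 -[1+ b ] z≢0 (mkℚ (+ suc p) q c) 0<ε = threshold a K , λ m M≤m →
  let 2a≤m = m+n≤o⇒m≤o (2 * a) M≤m
      a≤m  = ≤-trans (m≤n*m a 2) 2a≤m
      -- Positivity of m! - a comes from a < 2a ≤ m ≤ m!.
      a<m! = <-≤-trans (m<m+n a {a + 0} (s≤s z≤n)) (≤-trans 2a≤m (n≤n! m))
      a≤m! = <⇒≤ a<m!
  -- The integer sum computes to `m ! ⊖ a`, which is rewritten as the natural number `m ! ∸ a`.
  in subst (λ x → (+ 0 <ℤ x) × (∣ h ∣ x ∣ℤ - h a ∣ < mkℚ (+ suc p) q c)) (sym (ℤ.⊖-≥ a≤m!))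
  ( ℤ.+<+ (m<n⇒0<n∸m a<m!)
  , ∣h-h∣<ε K {{_}} {{>-nonZero (m<n⇒0<n∸m a<m!)}} refl M≤m
      (∣m+n∣m⇒∣n (subst (a ∣_) (sym (m+[n∸m]≡n a≤m!)) (m∣n! a≤m)) ∣-refl)
      (λ e∣m! e∣n → ∣m+n∣m⇒∣n (subst (_ ∣_) (sym (m∸n+n≡m a≤m!)) e∣m!) e∣n)
      (≤-trans (m∸n≤m (m !) a) (m≤n*m (m !) 2)) )
  where
  a K : ℕ
  a = suc b
  K = 6 + 6 * (σ a * suc q)
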